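{- Let $\Gamma\cup\{\varphi\}\subseteq{\bf F}(\Sigma,\mathcal{V})$ be finite. If $\Gamma\vdash_{\mathbb{T}_1}\varphi$ then $\Gamma\vDash^{\mathsf{RN}}_{\mathcal{RM}_{C_1}}\varphi$.
   Context: $\Sigma$ has unary $\neg$ and binary $\wedge,\vee,\to$. $\mathcal{A}_{C_1}$ is the $\Sigma$-multialgebra on $\{F,t,T\}$, $D=\{t,T\}$: $F\tilde\vee F=\{F\}$, $F\tilde\vee T=T\tilde\vee F=T\tilde\vee T=\{T\}$, $x\tilde\vee y=D$ if $t\in\{x,y\}$; $x\tilde\wedge y=\{F\}$ if $F\in\{x,y\}$, $T\tilde\wedge T=\{T\}$, $t\tilde\wedge t=t\tilde\wedge T=T\tilde\wedge t=D$; $\tilde\neg F=\{T\}$, $\tilde\neg t=D$, $\tilde\neg T=\{F\}$; $F\tilde\to F=F\tilde\to T=T\tilde\to T=\{T\}$, $t\tilde\to F=T\tilde\to F=\{F\}$, $x\tilde\to t=D$, $t\tilde\to T=D$. Valuations: $\nu(\neg\alpha)\in\tilde\neg\nu(\alpha)$, $\nu(\alpha\#\beta)\in\nu(\alpha)\tilde\#\nu(\beta)$; $\mathcal{F}_{C_1}$ = valuations with $\nu(\alpha)=t\Rightarrow\nu(\alpha\wedge\neg\alpha)=T$. $\Gamma\vDash^{\mathsf{RN}}_{\mathcal{RM}_{C_1}}\varphi$ iff every $\nu\in\mathcal{F}_{C_1}$ with $\nu[\Gamma]\subseteq D$ has $\nu(\varphi)\in D$. Tableau system $\mathbb{T}_1$: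 signed formulas $\mathsf{L}(\varphi)$ with $\mathsf{L}\in\{\mathsf{T},\mathsf{t},\mathsf{F}\}$. Rules (branches separated by $\mid$; commas inside a branch list formulas added together): $\mathsf{T}(\neg\varphi)$: $\mathsf{F}(\varphi)\mid\mathsf{t}(\varphi)$; $\mathsf{t}(\neg\varphi)$: $\mathsf{t}(\varphi)$; $\mathsf{F}(\neg\varphi)$: $\mathsf{T}(\varphi)$; $\mathsf{T}(\varphi\wedge\psi)$: $\mathsf{T}\varphi,\mathsf{T}\psi\mid\mathsf{T}\varphi,\mathsf{t}\psi\mid\mathsf{t}\varphi,\mathsf{T}\psi\mid\mathsf{t}\varphi,\mathsf{t}\psi$; $\mathsf{t}(\varphi\wedge\psi)$: $\mathsf{T}\varphi,\mathsf{t}\psi\mid\mathsf{t}\varphi,\mathsf{T}\psi\mid\mathsf{t}\varphi,\mathsf{t}\psi$; $\mathsf{F}(\varphi\wedge\psi)$: $\mathsf{F}\varphi\mid\mathsf{F}\psi$; $\mathsf{T}(\varphi\vee\psi)$: $\mathsf{T}\varphi\mid\mathsf{t}\varphi\mid\mathsf{T}\psi\mid\mathsf{t}\psi$; $\mathsf{t}(\varphi\vee\psi)$: $\mathsf{t}\varphi\mid\mathsf{t}\psi$; $\mathsf{F}(\varphi\vee\psi)$: $\mathsf{F}\varphi,\mathsf{F}\psi$; $\mathsf{T}(\varphi\to\psi)$: $\mathsf{F}\varphi\mid\mathsf{T}\psi\mid\mathsf{t}\psi$; $\mathsf{t}(\varphi\to\psi)$: $\mathsf{t}\varphi,\mathsf{T}\psi\mid\mathsf{t}\psi$;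 $\mathsf{F}(\varphi\to\psi)$: $\mathsf{T}\varphi,\mathsf{F}\psi\mid\mathsf{t}\varphi,\mathsf{F}\psi$. A branch is closed if it contains $\mathsf{L}(\psi)$ and $\mathsf{L}'(\psi)$ with $\mathsf{L}\ne\mathsf{L}'$, or some $\mathsf{t}(\psi\wedge\neg\psi)$. A tableau is closed if all its branches are closed (i.e., it contains no open complete branch). $\vdash_{\mathbb{T}_1}\varphi$ iff there is a closed tableau starting from $\mathsf{F}(\varphi)$; for $\Gamma=\{\gamma_1,\dots,\gamma_n\}$, $\Gamma\vdash_{\mathbb{T}_1}\varphi$ iff $\vdash_{\mathbb{T}_1}\gamma_1\to(\gamma_2\to\dots(\gamma_n\to\varphi)\dots)$. -}

module Defs where

open import Data.List using (List; []; _∷_; _++_; foldr)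
open import Data.List.Membership.Propositional renaming (_∈_ to _∈ˡ_) using ()
open import Data.List.Relation.Unary.All using (All; []; _∷_)
open import Data.Product using (Σ-syntax; ∃-syntax; _×_)
open import Level using (Level; 0ℓ; _⊔_)
open import Relation.Binary.PropositionalEquality using (_≡_; _≢_)
open import Relation.Unary using (Pred; _∈_; _∪_; _≐_; ｛_｝)

private
  variable
    v ℓ : Level
    V : Set v

infix  9 ¬_
infixr 8 _∧_
infixr 7 _∨_
infixr 6 _⇒_

-- F(Σ, 𝒱), over an arbitrary set V of propositional variables.
data Formula (V : Set v) : Set v where
  var         : V → Formula V
  ¬_          : Formula V → Formula V
  _∧_ _∨_ _⇒_ : Formula V → Formula V → Formula V

data 𝔸 : Set where
  F t T : 𝔸

D : Pred 𝔸 0ℓ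
D = ｛ t ｝ ∪ ｛ T ｝

¬̃_ : 𝔸 → Pred 𝔸 0ℓ
¬̃ F = ｛ T ｝
¬̃ t = D
¬̃ T = ｛ F ｝

_∧̃_ : 𝔸 → 𝔸 → Pred 𝔸 0ℓ
F ∧̃ F = ｛ F ｝
F ∧̃ t = ｛ F ｝
F ∧̃ T = ｛ F ｝
t ∧̃ F = ｛ F ｝
t ∧̃ t = D
t ∧̃ T = D
T ∧̃ F = ｛ F ｝
T ∧̃ t = D
T ∧̃ T = ｛ T ｝

_∨̃_ : 𝔸 → 𝔸 → Pred 𝔸 0ℓ
F ∨̃ F = ｛ F ｝
F ∨̃ t = D
F ∨̃ T = ｛ T ｝
t ∨̃ F = D
t ∨̃ t = D
t ∨̃ T = D
T ∨̃ F = ｛ T ｝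
T ∨̃ t = D
T ∨̃ T = ｛ T ｝

_⇒̃_ : 𝔸 → 𝔸 → Pred 𝔸 0ℓ
F ⇒̃ F = ｛ T ｝
F ⇒̃ t = D
F ⇒̃ T = ｛ T ｝
t ⇒̃ F = ｛ F ｝
t ⇒̃ t = D
t ⇒̃ T = D
T ⇒̃ F = ｛ F ｝
T ⇒̃ t = D
T ⇒̃ T = ｛ T ｝

record IsValuation {V : Set v} (ν : Formula V → 𝔸) : Set v where
  field
    ¬-val : ∀ α → ν (¬ α) ∈ ¬̃ (ν α)
    ∧-val : ∀ α β → ν (α ∧ β) ∈ (ν α ∧̃ ν β)
    ∨-val : ∀ α β → ν (α ∨ β) ∈ (ν α ∨̃ ν β)
    ⇒-val : ∀ α β → ν (α ⇒ β) ∈ (ν α ⇒̃ ν β)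

record ℱ-C₁ {V : Set v} (ν : Formula V → 𝔸) : Set v where
  field
    isValuation : IsValuation ν
    restriction : ∀ α → ν α ≡ t → ν (α ∧ ¬ α) ≡ T

infix 4 _⊨RN_

_⊨RN_ : {V : Set v} → Pred (Formula V) ℓ → Formula V → Set (v ⊔ ℓ)
Γ ⊨RN φ = ∀ ν → ν ∈ ℱ-C₁ → (∀ γ → γ ∈ Γ → ν γ ∈ D) → ν φ ∈ D

data Label : Set where
  𝖳 𝗍 𝖥 : Label

data Signed (V : Set v) : Set v where
  _⦅_⦆ : Label → Formula V → Signed V

-- A branch is the list of signed formulas occurring on it, latest first.
Branch : Set v → Set v
Branch V = List (Signed V)

-- Rule s bs: the rule with premise s has the conclusions bs, one list of
-- signed formulas for each branch it creates.
data Rule {V : Set v} : Signed V → List (List (Signed V)) → Set v where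
  𝖳¬ : ∀ {φ} → Rule (𝖳 ⦅ ¬ φ ⦆) ((𝖥 ⦅ φ ⦆ ∷ []) ∷ (𝗍 ⦅ φ ⦆ ∷ []) ∷ [])
  𝗍¬ : ∀ {φ} → Rule (𝗍 ⦅ ¬ φ ⦆) ((𝗍 ⦅ φ ⦆ ∷ []) ∷ [])
  𝖥¬ : ∀ {φ} → Rule (𝖥 ⦅ ¬ φ ⦆) ((𝖳 ⦅ φ ⦆ ∷ []) ∷ [])
  𝖳∧ : ∀ {φ ψ} → Rule (𝖳 ⦅ φ ∧ ψ ⦆)
         ( (𝖳 ⦅ φ ⦆ ∷ 𝖳 ⦅ ψ ⦆ ∷ [])
         ∷ (𝖳 ⦅ φ ⦆ ∷ 𝗍 ⦅ ψ ⦆ ∷ [])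
         ∷ (𝗍 ⦅ φ ⦆ ∷ 𝖳 ⦅ ψ ⦆ ∷ [])
         ∷ (𝗍 ⦅ φ ⦆ ∷ 𝗍 ⦅ ψ ⦆ ∷ [])
         ∷ [])
  𝗍∧ : ∀ {φ ψ} → Rule (𝗍 ⦅ φ ∧ ψ ⦆)
         ( (𝖳 ⦅ φ ⦆ ∷ 𝗍 ⦅ ψ ⦆ ∷ [])
         ∷ (𝗍 ⦅ φ ⦆ ∷ 𝖳 ⦅ ψ ⦆ ∷ [])
         ∷ (𝗍 ⦅ φ ⦆ ∷ 𝗍 ⦅ ψ ⦆ ∷ [])
         ∷ [])
  𝖥∧ : ∀ {φ ψ} → Rule (𝖥 ⦅ φ ∧ ψ ⦆) ((𝖥 ⦅ φ ⦆ ∷ []) ∷ (𝖥 ⦅ ψ ⦆ ∷ []) ∷ [])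
  𝖳∨ : ∀ {φ ψ} → Rule (𝖳 ⦅ φ ∨ ψ ⦆)
         ( (𝖳 ⦅ φ ⦆ ∷ [])
         ∷ (𝗍 ⦅ φ ⦆ ∷ [])
         ∷ (𝖳 ⦅ ψ ⦆ ∷ [])
         ∷ (𝗍 ⦅ ψ ⦆ ∷ [])
         ∷ [])
  𝗍∨ : ∀ {φ ψ} → Rule (𝗍 ⦅ φ ∨ ψ ⦆) ((𝗍 ⦅ φ ⦆ ∷ []) ∷ (𝗍 ⦅ ψ ⦆ ∷ []) ∷ [])
  𝖥∨ : ∀ {φ ψ} → Rule (𝖥 ⦅ φ ∨ ψ ⦆) ((𝖥 ⦅ φ ⦆ ∷ 𝖥 ⦅ ψ ⦆ ∷ []) ∷ [])
  𝖳⇒ : ∀ {φ ψ} → Rule (𝖳 ⦅ φ ⇒ ψ ⦆)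
         ( (𝖥 ⦅ φ ⦆ ∷ [])
         ∷ (𝖳 ⦅ ψ ⦆ ∷ [])
         ∷ (𝗍 ⦅ ψ ⦆ ∷ [])
         ∷ [])
  𝗍⇒ : ∀ {φ ψ} → Rule (𝗍 ⦅ φ ⇒ ψ ⦆)
         ( (𝗍 ⦅ φ ⦆ ∷ 𝖳 ⦅ ψ ⦆ ∷ [])
         ∷ (𝗍 ⦅ ψ ⦆ ∷ [])
         ∷ [])
  𝖥⇒ : ∀ {φ ψ} → Rule (𝖥 ⦅ φ ⇒ ψ ⦆)
         ( (𝖳 ⦅ φ ⦆ ∷ 𝖥 ⦅ ψ ⦆ ∷ [])
         ∷ (𝗍 ⦅ φ ⦆ ∷ 𝖥 ⦅ ψ ⦆ ∷ [])
         ∷ [])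

-- Tableau θ: the part of a finite tableau lying below the initial segment θ
-- of a branch; a tableau starting from s is an element of Tableau (s ∷ []).
data Tableau {V : Set v} (θ : Branch V) : Set v where
  end    : Tableau θ
  extend : ∀ {s bs} → s ∈ˡ θ → Rule s bs →
           All (λ b → Tableau (b ++ θ)) bs → Tableau θ

branches    : {θ : Branch V} → Tableau θ → List (Branch V)
branchesAll : {θ : Branch V} {bs : List (List (Signed V))} →
              All (λ b → Tableau (b ++ θ)) bs → List (Branch V)

branches {θ = θ} end     = θ ∷ []
branches (extend _ _ τs) = branchesAll τs

branchesAll []       = []
branchesAll (τ ∷ τs) = branches τ ++ branchesAll τs

data ClosedBranch {V : Set v} (θ : Branch V) : Set v where
  clash : ∀ {L L′ ψ} → L ⦅ ψ ⦆ ∈ˡ θ → L′ ⦅ ψ ⦆ ∈ˡ θ → L ≢ L′ → ClosedBranch θ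
  contr : ∀ {ψ} → 𝗍 ⦅ ψ ∧ ¬ ψ ⦆ ∈ˡ θ → ClosedBranch θ

ClosedTableau : {V : Set v} {θ : Branch V} → Tableau θ → Set v
ClosedTableau τ = All ClosedBranch (branches τ)

infix 4 ⊢𝕋₁_ _⊢𝕋₁_

⊢𝕋₁_ : {V : Set v} → Formula V → Set v
⊢𝕋₁_ φ = Σ[ τ ∈ Tableau (𝖥 ⦅ φ ⦆ ∷ []) ] ClosedTableau τ

_Enumerates_ : {V : Set v} → List (Formula V) → Pred (Formula V) ℓ → Set (v ⊔ ℓ)
γs Enumerates Γ = Γ ≐ (_∈ˡ γs)

Finite : {V : Set v} → Pred (Formula V) ℓ → Set (v ⊔ ℓ)
Finite Γ = ∃[ γs ] γs Enumerates Γ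

-- The order of γ₁, …, γₙ is not determined by the set Γ: some enumeration
-- (possibly with repetitions) is required to give a provable formula.
_⊢𝕋₁_ : {V : Set v} → Pred (Formula V) ℓ → Formula V → Set (v ⊔ ℓ)
Γ ⊢𝕋₁ φ = ∃[ γs ] γs Enumerates Γ × (⊢𝕋₁ foldr _⇒_ φ γs)

{-# OPTIONS --safe #-}
module Submission where

-- Read a signed formula L(φ) as the assertion that ν takes the value L at φ.
-- For ν in ℱ-C₁ every rule preserves truth along at least one of its branches,
-- so a tableau whose root is true at ν has a branch all of whose formulas are
-- true at ν, and such a branch cannot be closed.  A valuation refuting
-- Γ ⊨RN φ makes the root 𝖥(γ₁ ⇒ … ⇒ γₙ ⇒ φ) true.

open import Defs
open import Data.Empty using (⊥)
open import Data.List using ([]; _∷_; _++_; foldr)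
open import Data.List.Relation.Unary.All using (All; []; _∷_; lookup; lookupAny; tabulate)
open import Data.List.Relation.Unary.All.Properties using () renaming (++⁺ to All-++⁺)
open import Data.List.Relation.Unary.Any using (Any; here; there)
open import Data.List.Relation.Unary.Any.Properties using (++⁺ˡ; ++⁺ʳ)
open import Data.Product using (_,_)
open import Data.Sum using (inj₁; inj₂)
open import Level using (Level)
open import Relation.Binary.PropositionalEquality using (_≡_; _≢_; refl; sym; trans; subst)
open import Relation.Nullary using (contradiction)
open import Relation.Unary using (Pred; _∈_; _∉_)

⟦_⟧ : Label → 𝔸
⟦ 𝖳 ⟧ = T
⟦ 𝗍 ⟧ = t
⟦ 𝖥 ⟧ = F

⟦⟧-injective : ∀ {L L′} → ⟦ L ⟧ ≡ ⟦ L′ ⟧ → L ≡ L′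
⟦⟧-injective {𝖳} {𝖳} _ = refl
⟦⟧-injective {𝗍} {𝗍} _ = refl
⟦⟧-injective {𝖥} {𝖥} _ = refl

F∉D : F ∉ D
F∉D (inj₁ ())
F∉D (inj₂ ())

≢F⇒∈D : ∀ {x} → x ≢ F → x ∈ D
≢F⇒∈D {F} x≢F = contradiction refl x≢F
≢F⇒∈D {t} _   = inj₁ refl
≢F⇒∈D {T} _   = inj₂ refl

∈D⇒F : ∀ {x y} → x ∈ D → y ∈ x ⇒̃ F → y ≡ F
∈D⇒F (inj₁ refl) refl = refl
∈D⇒F (inj₂ refl) refl = refl

module _ {v : Level} {V : Set v} (ν : Formula V → 𝔸) where

  Holds : Signed V → Set
  Holds (L ⦅ φ ⦆) = ν φ ≡ ⟦ L ⟧

  module _ (ν∈ℱ : ν ∈ ℱ-C₁) where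

    open ℱ-C₁ ν∈ℱ
    open IsValuation isValuation

    -- Each rule reads a table backwards: its branches list the arguments at which the
    -- multioperation can return the value named by the premise. `subst` places that value in the
    -- table entry, so splitting on the values of the subformulas leaves only the listed arguments.
    rule-sound : ∀ {s bs} → Rule s bs → Holds s → Any (All Holds) bs
    rule-sound (𝖳¬ {φ}) h with ν φ in p | subst (_∈ ¬̃ ν φ) h (¬-val φ)
    ... | F | _ = here (p ∷ [])
    ... | t | _ = there (here (p ∷ []))
    rule-sound (𝗍¬ {φ}) h with ν φ in p | subst (_∈ ¬̃ ν φ) h (¬-val φ)
    ... | t | _ = here (p ∷ [])
    rule-sound (𝖥¬ {φ}) h with ν φ in p | subst (_∈ ¬̃ ν φ) h (¬-val φ)
    -- The entry here is `D`, so the impossible membership is a sum of two absurd equations, and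
    -- both summands have to be refuted.
    ... | t | F∈D = contradiction F∈D F∉D
    ... | T | _ = here (p ∷ [])
    rule-sound (𝖳∧ {φ} {ψ}) h with ν φ in p | ν ψ in q | subst (_∈ ν φ ∧̃ ν ψ) h (∧-val φ ψ)
    ... | F | F | ()
    ... | t | F | ()
    ... | T | F | ()
    ... | T | T | _ = here (p ∷ q ∷ [])
    ... | T | t | _ = there (here (p ∷ q ∷ []))
    ... | t | T | _ = there (there (here (p ∷ q ∷ [])))
    ... | t | t | _ = there (there (there (here (p ∷ q ∷ []))))
    rule-sound (𝗍∧ {φ} {ψ}) h with ν φ in p | ν ψ in q | subst (_∈ ν φ ∧̃ ν ψ) h (∧-val φ ψ)
    ... | F | F | ()
    ... | t | F | ()
    ... | T | F | ()
    ... | T | t | _ = here (p ∷ q ∷ [])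
    ... | t | T | _ = there (here (p ∷ q ∷ []))
    ... | t | t | _ = there (there (here (p ∷ q ∷ [])))
    rule-sound (𝖥∧ {φ} {ψ}) h with ν φ in p | ν ψ in q | subst (_∈ ν φ ∧̃ ν ψ) h (∧-val φ ψ)
    ... | F | _ | _ = here (p ∷ [])
    ... | t | F | _ = there (here (q ∷ []))
    ... | T | F | _ = there (here (q ∷ []))
    ... | t | t | F∈D = contradiction F∈D F∉D
    ... | t | T | F∈D = contradiction F∈D F∉D
    ... | T | t | F∈D = contradiction F∈D F∉D
    rule-sound (𝖳∨ {φ} {ψ}) h with ν φ in p | ν ψ in q | subst (_∈ ν φ ∨̃ ν ψ) h (∨-val φ ψ)
    -- Several branches can be true at once; a designated `φ` already selects one, and `ψ` is
    -- consulted only when `φ` has value `F`.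
    ... | T | _ | _ = here (p ∷ [])
    ... | t | _ | _ = there (here (p ∷ []))
    ... | F | T | _ = there (there (here (q ∷ [])))
    ... | F | t | _ = there (there (there (here (q ∷ []))))
    rule-sound (𝗍∨ {φ} {ψ}) h with ν φ in p | ν ψ in q | subst (_∈ ν φ ∨̃ ν ψ) h (∨-val φ ψ)
    ... | t | _ | _ = here (p ∷ [])
    ... | F | t | _ = there (here (q ∷ []))
    ... | T | t | _ = there (here (q ∷ []))
    rule-sound (𝖥∨ {φ} {ψ}) h with ν φ in p | ν ψ in q | subst (_∈ ν φ ∨̃ ν ψ) h (∨-val φ ψ)
    ... | F | F | _ = here (p ∷ q ∷ [])
    ... | F | t | F∈D = contradiction F∈D F∉D
    ... | t | F | F∈D = contradiction F∈D F∉D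
    ... | t | t | F∈D = contradiction F∈D F∉D
    ... | t | T | F∈D = contradiction F∈D F∉D
    ... | T | t | F∈D = contradiction F∈D F∉D
    rule-sound (𝖳⇒ {φ} {ψ}) h with ν φ in p | ν ψ in q | subst (_∈ ν φ ⇒̃ ν ψ) h (⇒-val φ ψ)
    ... | F | _ | _ = here (p ∷ [])
    ... | t | T | _ = there (here (q ∷ []))
    ... | T | T | _ = there (here (q ∷ []))
    ... | t | t | _ = there (there (here (q ∷ [])))
    ... | T | t | _ = there (there (here (q ∷ [])))
    rule-sound (𝗍⇒ {φ} {ψ}) h with ν φ in p | ν ψ in q | subst (_∈ ν φ ⇒̃ ν ψ) h (⇒-val φ ψ)
    ... | t | T | _ = here (p ∷ q ∷ [])
    ... | F | t | _ = there (here (q ∷ []))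
    ... | t | t | _ = there (here (q ∷ []))
    ... | T | t | _ = there (here (q ∷ []))
    rule-sound (𝖥⇒ {φ} {ψ}) h with ν φ in p | ν ψ in q | subst (_∈ ν φ ⇒̃ ν ψ) h (⇒-val φ ψ)
    ... | T | F | _ = here (p ∷ q ∷ [])
    ... | t | F | _ = there (here (p ∷ q ∷ []))
    ... | F | t | F∈D = contradiction F∈D F∉D
    ... | t | t | F∈D = contradiction F∈D F∉D
    ... | t | T | F∈D = contradiction F∈D F∉D
    ... | T | t | F∈D = contradiction F∈D F∉D

    -- Induction on the tableau, descending at each extension into a child that `rule-sound` makes
    -- true. The whole segment `θ` is kept true because a rule may be applied to any earlier formula
    -- on it.
    branch-holds : ∀ {θ} (τ : Tableau θ) → All Holds θ → Any (All Holds) (branches τ)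
    branchAll-holds : ∀ {θ bs} (τs : All (λ b → Tableau (b ++ θ)) bs) → All Holds θ →
                      Any (All Holds) bs → Any (All Holds) (branchesAll τs)

    branch-holds end               hθ = here hθ
    branch-holds (extend s∈θ r τs) hθ = branchAll-holds τs hθ (rule-sound r (lookup hθ s∈θ))

    branchAll-holds (τ ∷ τs) hθ (here hb)  = ++⁺ˡ (branch-holds τ (All-++⁺ hb hθ))
    branchAll-holds (τ ∷ τs) hθ (there hs) = ++⁺ʳ (branches τ) (branchAll-holds τs hθ hs)

    -- If `ψ` has value `F` or `T`, one conjunct is `F` and the table forces `F`. If `ψ` has value
    -- `t`, the table still allows `t`; it is the restriction defining `ℱ-C₁` that forces `T`.
    contradiction≢t : ∀ ψ → ν (ψ ∧ ¬ ψ) ≢ t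
    contradiction≢t ψ h with ν ψ in p | ν (¬ ψ) | ¬-val ψ | subst (_∈ ν ψ ∧̃ ν (¬ ψ)) h (∧-val ψ (¬ ψ))
    ... | F | _ | refl | ()
    ... | t | _ | _    | _ with () ← trans (sym h) (restriction ψ p)
    ... | T | _ | refl | ()

    closed⇒¬holds : ∀ {θ} → ClosedBranch θ → All Holds θ → ⊥
    closed⇒¬holds (clash a b L≢L′) hθ = L≢L′ (⟦⟧-injective (trans (sym (lookup hθ a)) (lookup hθ b)))
    closed⇒¬holds (contr {ψ} a)    hθ = contradiction≢t ψ (lookup hθ a)

    ⊢𝕋₁⇒≢F : ∀ {φ} → ⊢𝕋₁ φ → ν φ ≢ F
    ⊢𝕋₁⇒≢F (τ , closed) νφ≡F =
      -- All branches are closed and some branch is true, so one branch is both.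
      let c , h = lookupAny closed (branch-holds τ (νφ≡F ∷ [])) in closed⇒¬holds c h

    -- An implication from a designated value to `F` can only be `F`, so the value `F` of `φ`
    -- propagates outwards through the nested implications.
    foldr-⇒≡F : ∀ {φ} γs → All (λ γ → ν γ ∈ D) γs → ν φ ≡ F → ν (foldr _⇒_ φ γs) ≡ F
    foldr-⇒≡F []       _        νφ≡F = νφ≡F
    foldr-⇒≡F (γ ∷ γs) (d ∷ ds) νφ≡F =
      ∈D⇒F d (subst (λ y → ν (γ ⇒ _) ∈ ν γ ⇒̃ y) (foldr-⇒≡F γs ds νφ≡F) (⇒-val γ _))

mainTheorem14 : ∀ {v ℓ : Level} {V : Set v} (Γ : Pred (Formula V) ℓ) (φ : Formula V) → Finite Γ → Γ ⊢𝕋₁ φ → Γ ⊨RN φ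
mainTheorem14 Γ φ _ (γs , (_ , γs⊆Γ) , ⊢γs⇒φ) ν ν∈ℱ νΓ⊆D =
  ≢F⇒∈D λ νφ≡F → ⊢𝕋₁⇒≢F ν ν∈ℱ ⊢γs⇒φ
    -- Every listed premise lies in `Γ` and is therefore designated.
    (foldr-⇒≡F ν ν∈ℱ γs (tabulate λ {γ} γ∈γs → νΓ⊆D γ (γs⊆Γ γ∈γs)) νφ≡F)
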